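{- Let $G$ be a graph that contains an induced $(n,m)$-necklace, with $n\geq 5$ and $m\geq 1$, whose cycle has good neighbors in $G$. Then $G$ diverges under the operator $KB_e$, i.e. $\lim_{k\to\infty}|V(KB_e^k(G))|=\infty$.
   Context: All graphs are finite, simple and undirected. A biclique of a graph $G$ is a maximal induced complete bipartite subgraph of $G$. The edge-biclique graph $KB_e(G)$ has one vertex for each biclique of $G$, two vertices being adjacent when the corresponding bicliques share at least one edge; $KB_e^0(G)=G$, $KB_e^k(G)=KB_e(KB_e^{k-1}(G))$. For $n\ge 3$, $m\ge 1$, the $(n,m)$-necklace is the graph on $n+m$ vertices consisting of an induced cycle $C_n$ and a complete graph $K_m$ such that, for one fixed edge $e$ of $C_n$, every vertex of $K_m$ is adjacent to both endpoints of $e$ and to no other vertex of $C_n$. An induced cycle $C=v_0\ldots v_{n-1}$ ($n\ge 5$) of a graph $H$ has good neighbors if for every vertex $v\in V(H)\setminus V(C)$ and every $i$ (indices mod $n$), if $v$ is adjacent to both $v_{i-1}$ and $v_{i+1}$ then $v$ is adjacent to $v_i$. -}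

module Defs where

open import Data.Bool using (Bool; true; false; _∧_; _∨_; not; if_then_else_)
open import Data.Nat using (ℕ; zero; suc; _≤_; _≡ᵇ_; _<ᵇ_; _+_)
open import Data.Fin using (Fin; toℕ; splitAt; _↑ˡ_)
open import Data.Sum using (_⊎_; inj₁; inj₂)
open import Data.Product using (Σ; ∃; _×_; _,_)
open import Data.List using (List; []; _∷_; _++_; map; length; lookup; filterᵇ; allFin)
open import Data.Bool.ListAction using (all; any)
open import Data.Vec using (Vec; []; _∷_) renaming (lookup to vlookup)
open import Relation.Binary.PropositionalEquality using (_≡_; _≢_)
open import Function.Definitions using (Injective)

record Graph : Set where
  constructor mkGraph
  field
    size : ℕ
    E    : Fin size → Fin size → Bool
open Graph public

V : Graph → Set
V G = Fin (size G)

Adj : (G : Graph) → V G → V G → Set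
Adj G u v = E G u v ≡ true

record Simple (G : Graph) : Set where
  field
    sym   : ∀ u v → E G u v ≡ E G v u
    irref : ∀ u → E G u u ≡ false

Subset : ℕ → Set
Subset n = Vec Bool n

allSubsets : (n : ℕ) → List (Subset n)
allSubsets zero    = [] ∷ []
allSubsets (suc n) = map (true ∷_) (allSubsets n) ++ map (false ∷_) (allSubsets n)

_∈ᵇ_ : ∀ {n} → Fin n → Subset n → Bool
i ∈ᵇ S = vlookup S i

_⊆ᵇ_ : ∀ {n} → Subset n → Subset n → Bool
_⊆ᵇ_ {n} S T = all (λ i → not (i ∈ᵇ S) ∨ (i ∈ᵇ T)) (allFin n)

_⇒ᵇ_ : Bool → Bool → Bool
a ⇒ᵇ b = not a ∨ b

_≡Fᵇ_ : ∀ {n} → Fin n → Fin n → Bool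
i ≡Fᵇ j = toℕ i ≡ᵇ toℕ j

-- G[S] is complete bipartite with (nonempty) parts S∩X and S∖X:
-- two vertices of S are adjacent iff they lie in different parts.
CBwith : (G : Graph) → Subset (size G) → Subset (size G) → Bool
CBwith G S X =
  any (λ u → (u ∈ᵇ S) ∧ (u ∈ᵇ X)) (allFin (size G)) ∧
  any (λ u → (u ∈ᵇ S) ∧ not (u ∈ᵇ X)) (allFin (size G)) ∧
  all (λ u → all (λ v →
        ((u ∈ᵇ S) ∧ (v ∈ᵇ S)) ⇒ᵇ
        (if E G u v then not (sameSide u v) else sameSide u v))
      (allFin (size G))) (allFin (size G))
  where
  sameSide : V G → V G → Bool
  sameSide u v = if u ∈ᵇ X then v ∈ᵇ X else not (v ∈ᵇ X)

isCB : (G : Graph) → Subset (size G) → Bool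
isCB G S = any (CBwith G S) (allSubsets (size G))

isBiclique : (G : Graph) → Subset (size G) → Bool
isBiclique G S =
  isCB G S ∧
  all (λ T → not ((S ⊆ᵇ T) ∧ not (T ⊆ᵇ S) ∧ isCB G T)) (allSubsets (size G))

bicliques : (G : Graph) → List (Subset (size G))
bicliques G = filterᵇ (isBiclique G) (allSubsets (size G))

shareEdge : (G : Graph) → Subset (size G) → Subset (size G) → Bool
shareEdge G B₁ B₂ =
  any (λ u → any (λ v →
        (u ∈ᵇ B₁) ∧ (v ∈ᵇ B₁) ∧ (u ∈ᵇ B₂) ∧ (v ∈ᵇ B₂) ∧ E G u v)
      (allFin (size G))) (allFin (size G))

KBe : Graph → Graph
KBe G = mkGraph (length (bicliques G))
  (λ i j → not (i ≡Fᵇ j) ∧ shareEdge G (lookup (bicliques G) i) (lookup (bicliques G) j))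

KBe^ : ℕ → Graph → Graph
KBe^ zero    G = G
KBe^ (suc k) G = KBe (KBe^ k G)

Diverges : Graph → Set
Diverges G = ∀ (N : ℕ) → ∃ λ (K : ℕ) → ∀ (k : ℕ) → K ≤ k → N ≤ size (KBe^ k G)

succᵇ : (n : ℕ) → Fin n → Fin n → Bool
succᵇ n i j = (suc (toℕ i) ≡ᵇ toℕ j) ∨ ((suc (toℕ i) ≡ᵇ n) ∧ (toℕ j ≡ᵇ 0))

-- the (n,m)-necklace: vertices i ↑ˡ m (i : Fin n) form the cycle v₀…v_{n-1},
-- the remaining m vertices form K_m, each adjacent exactly to v₀ and v₁
-- (the fixed edge e = v₀v₁).
necklaceAdj : (n m : ℕ) → Fin (n + m) → Fin (n + m) → Bool
necklaceAdj n m x y with splitAt n x | splitAt n y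
... | inj₁ i | inj₁ j = succᵇ n i j ∨ succᵇ n j i
... | inj₂ a | inj₂ b = not (a ≡Fᵇ b)
... | inj₁ i | inj₂ b = toℕ i <ᵇ 2
... | inj₂ a | inj₁ j = toℕ j <ᵇ 2

Necklace : ℕ → ℕ → Graph
Necklace n m = mkGraph (n + m) (necklaceAdj n m)

InducedEmbedding : (H G : Graph) → (V H → V G) → Set
InducedEmbedding H G f = Injective _≡_ _≡_ f × (∀ x y → E H x y ≡ E G (f x) (f y))

GoodNeighbors : (G : Graph) (n : ℕ) → (Fin n → V G) → Set
GoodNeighbors G n c =
  ∀ (v : V G) → (∀ i → v ≢ c i) →
  ∀ (h i j : Fin n) → succᵇ n h i ≡ true → succᵇ n i j ≡ true →
  Adj G v (c h) → Adj G v (c j) → Adj G v (c i)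

{-# OPTIONS --safe #-}
module Submission where

-- Good neighbours force every biclique Bᵢ ⊇ {vᵢ, vᵢ₊₁, vᵢ₊₂} to be a star centred at vᵢ₊₁, and
-- then the Bᵢ form a cycle with good neighbours in KBe G.  Call a vertex u "on" the edge vᵢvᵢ₊₁
-- if it is adjacent to both ends but to neither vᵢ₋₁ nor vᵢ₊₂.  A biclique extending the star
-- {vᵢ₊₁; vᵢ₊₂, u} is on the edge of the new cycle given by vᵢ₊₁vᵢ₊₂, and one extending
-- {vᵢ; vᵢ₋₁, u} is on the edge given by vᵢ₋₁vᵢ, so each vertex on an edge passes to both
-- neighbouring edges.  Vertices of KBe G on one edge are pairwise adjacent, so distinct ones
-- yield distinct bicliques.  From the second iterate on, vertices on two edges at distance one
-- are nonadjacent, so the contributions which an edge receives from its left and from its right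
-- are also distinct.  Hence at each step the family on one edge gains a member from a vertex
-- that persists two edges further along the cycle.

open import Defs
open import Data.Bool using (Bool; true; false; _∧_; _∨_; not; if_then_else_; T)
import Data.Bool as Bool
open import Data.Bool.ListAction using (all; any)
open import Data.Bool.Properties using (T-≡; ¬-not)
open import Data.Empty using (⊥; ⊥-elim)
open import Data.Fin using (Fin; zero; suc; toℕ; _↑ˡ_; _↑ʳ_)
open import Data.Fin.Properties
  using (toℕ-injective; toℕ-fromℕ<; toℕ<n; splitAt-↑ˡ; splitAt-↑ʳ; ↑ˡ-injective; injective⇒≤;
         any?)
  renaming (_≟_ to _≟F_)
import Data.Fin.Subset as Subset
open import Data.Fin.Subset.Induction using (⊃-wellFounded)
open import Data.List using (List; lookup; allFin)
open import Data.List.Membership.Propositional using (find; lose) renaming (_∈_ to _∈ₗ_)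
open import Data.List.Membership.Propositional.Properties
  using (∈-allFin; ∈-filter⁺; ∈-filter⁻; ∈-lookup; ∈-map⁺; ∈-++⁺ˡ; ∈-++⁺ʳ)
import Data.List.Relation.Unary.All as All
import Data.List.Relation.Unary.All.Properties as All
import Data.List.Relation.Unary.Any as Any
import Data.List.Relation.Unary.Any.Properties as Any
open import Data.Nat
  using (ℕ; zero; suc; _≤_; _<_; _+_; _∸_; _%_; _≡ᵇ_; _<ᵇ_; NonZero; s≤s)
open import Data.Nat.DivMod
  using (_mod_; m%n<n; m%n%n≡m%n; %-distribˡ-+; m<n⇒m%n≡m; n%n≡0; m≤n⇒[n∸m]%m≡n%m)
open import Data.Nat.Properties
  using (≡⇒≡ᵇ; ≡ᵇ⇒≡; suc-injective; m≤n⇒m<n∨m≡n; ≤-trans; ≤-refl; <-irrefl; m≤m+n; m≤n+m;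
         n≤1+n; m+[n∸m]≡n; m∸n+n≡m; +-mono-<; m≢1+n+m; +-cancelʳ-≡; +-cancelʳ-<; +-comm; ≮⇒≥; _<?_)
open import Data.Product using (∃; _×_; _,_; proj₁; proj₂)
open import Data.Sum using (_⊎_; inj₁; inj₂; [_,_]′; swap)
open import Data.Vec using ([]; _∷_; tabulate)
open import Data.Vec.Properties using (lookup∘tabulate; []=⇒lookup; lookup⇒[]=)
open import Function using (_∘_; Equivalence; Injective)
open import Induction.WellFounded using (Acc; acc)
open import Relation.Binary.PropositionalEquality
open import Relation.Nullary using (¬_; Dec; does; yes; no; contradiction)
open import Relation.Nullary.Decidable using (_⊎-dec_; dec-true; dec-false)

-- Boolean reflection and search over finite lists

private variable
  A : Set
  xs : List A
  n : ℕ

⇒T : ∀ {b} → b ≡ true → T b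
⇒T = Equivalence.from T-≡

T⇒ : ∀ {b} → T b → b ≡ true
T⇒ = Equivalence.to T-≡

∧-intro : ∀ {a b} → a ≡ true → b ≡ true → a ∧ b ≡ true
∧-intro refl refl = refl

∧-elim : ∀ {a b} → a ∧ b ≡ true → a ≡ true × b ≡ true
∧-elim {true} {true} _ = refl , refl

∨-introˡ : ∀ {a b} → a ≡ true → a ∨ b ≡ true
∨-introˡ refl = refl

∨-introʳ : ∀ {a b} → b ≡ true → a ∨ b ≡ true
∨-introʳ {true}  _ = refl
∨-introʳ {false} h = h

∧-falseʳ : ∀ {a b} → a ≡ true → a ∧ b ≡ false → b ≡ false
∧-falseʳ refl h = h

⇔⇒≡ : ∀ {a b} → (a ≡ true → b ≡ true) → (b ≡ true → a ≡ true) → a ≡ b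
⇔⇒≡ {true}          f g = sym (f refl)
⇔⇒≡ {false} {true}  f g = g refl
⇔⇒≡ {false} {false} f g = refl

⇒-intro : ∀ {a b} → (a ≡ true → b ≡ true) → not a ∨ b ≡ true
⇒-intro {true}  h = h refl
⇒-intro {false} h = refl

⇒-elim : ∀ {a b} → not a ∨ b ≡ true → a ≡ true → b ≡ true
⇒-elim {true} h refl = h

any-intro : (p : A → Bool) {x : A} → x ∈ₗ xs → p x ≡ true → any p xs ≡ true
any-intro p x∈ px = T⇒ (Any.any⁺ p (lose x∈ (⇒T px)))

any-elim : (p : A → Bool) (xs : List A) → any p xs ≡ true → ∃ λ x → p x ≡ true
any-elim p xs h with x , _ , px ← find (Any.any⁻ p xs (⇒T h)) = x , T⇒ px

anyFin-intro : (p : Fin n → Bool) (x : Fin n) → p x ≡ true → any p (allFin n) ≡ true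
anyFin-intro p x = any-intro p (∈-allFin x)

allFin-intro : (p : Fin n → Bool) → (∀ x → p x ≡ true) → all p (allFin n) ≡ true
allFin-intro p h = T⇒ (All.all⁻ p {xs = allFin _} (All.tabulate λ {x} _ → ⇒T (h x)))

allFin-elim : (p : Fin n → Bool) → all p (allFin n) ≡ true → ∀ x → p x ≡ true
allFin-elim p h x = T⇒ (All.lookup (All.all⁺ p (allFin _) (⇒T h)) (∈-allFin x))

all-refute : (p : A → Bool) (xs : List A) → all (not ∘ p) xs ≡ false → ∃ λ x → p x ≡ true
all-refute p (x List.∷ xs) h with p x in eq
... | true  = x , eq
... | false = all-refute p xs h

∈-allSubsets : (S : Subset n) → S ∈ₗ allSubsets n
∈-allSubsets []          = Any.here refl
∈-allSubsets (true ∷ S)  = ∈-++⁺ˡ (∈-map⁺ (true ∷_) (∈-allSubsets S))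
∈-allSubsets (false ∷ S) = ∈-++⁺ʳ _ (∈-map⁺ (false ∷_) (∈-allSubsets S))

⊆ᵇ-elim : (S T : Subset n) → S ⊆ᵇ T ≡ true → ∀ x → x ∈ᵇ S ≡ true → x ∈ᵇ T ≡ true
⊆ᵇ-elim S T h x = ⇒-elim (allFin-elim (λ i → not (i ∈ᵇ S) ∨ (i ∈ᵇ T)) h x)

⊈ᵇ-elim : (S T : Subset n) → not (S ⊆ᵇ T) ≡ true → ∃ λ x → x ∈ᵇ S ≡ true × ¬ (x ∈ᵇ T ≡ true)
⊈ᵇ-elim S T h with any? (λ x → ((x ∈ᵇ S) ∧ not (x ∈ᵇ T)) Bool.≟ true)
... | yes (x , p) = x , proj₁ (∧-elim p) , λ q →
    contradiction (trans (sym (cong not q)) (proj₂ (∧-elim p))) λ ()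
... | no  none    = contradiction (trans (sym (cong not sub)) h) λ ()
  where
  sub : S ⊆ᵇ T ≡ true
  sub = allFin-intro (λ i → not (i ∈ᵇ S) ∨ (i ∈ᵇ T)) λ x → ⇒-intro (xT x)
    where
    xT : ∀ x → x ∈ᵇ S ≡ true → x ∈ᵇ T ≡ true
    xT x x∈S with x ∈ᵇ T in eq
    ... | true  = refl
    ... | false = ⊥-elim (none (x , ∧-intro x∈S (cong not eq)))

≡Fᵇ-refl : (i : Fin n) → (i ≡Fᵇ i) ≡ true
≡Fᵇ-refl i = T⇒ (≡⇒≡ᵇ (toℕ i) (toℕ i) refl)

≢⇒≡Fᵇ-false : {i j : Fin n} → i ≢ j → (i ≡Fᵇ j) ≡ false
≢⇒≡Fᵇ-false {i = i} {j} i≢j = ¬-not λ h → i≢j (toℕ-injective (≡ᵇ⇒≡ (toℕ i) (toℕ j) (⇒T h)))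

dec-true⁻ : (d : Dec A) → does d ≡ true → A
dec-true⁻ (yes a) _ = a

-- Bicliques of a graph and adjacency in `KBe G`

Adj-sym : ∀ {G} → Simple G → ∀ u v → Adj G u v → Adj G v u
Adj-sym simple u v h = trans (Simple.sym simple v u) h

Adj-irrefl : ∀ {G} → Simple G → ∀ u v → Adj G u v → u ≢ v
Adj-irrefl simple u u h refl = contradiction (trans (sym h) (Simple.irref simple u)) λ ()

module Adjacency (G : Graph) where

  infix 4 _~_ _≁_

  _~_ _≁_ : V G → V G → Set
  u ~ v = Adj G u v
  u ≁ v = ¬ Adj G u v

module Biclique (G : Graph) where

  open Adjacency G

  infix 4 _∈_

  _∈_ : V G → V (KBe G) → Set
  x ∈ k = x ∈ᵇ lookup (bicliques G) k ≡ true

  consistent : Subset (size G) → Subset (size G) → V G → V G → Bool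
  consistent S X u v = ((u ∈ᵇ S) ∧ (v ∈ᵇ S)) ⇒ᵇ (if E G u v then not same else same)
    where same = if u ∈ᵇ X then v ∈ᵇ X else not (v ∈ᵇ X)

  -- The right-hand side is an exclusive or: true exactly when `u` and `v` lie on opposite sides of
  -- `X`.
  CBwith-elim : ∀ S X {u v} → CBwith G S X ≡ true → u ∈ᵇ S ≡ true → v ∈ᵇ S ≡ true →
    E G u v ≡ (if u ∈ᵇ X then not (v ∈ᵇ X) else v ∈ᵇ X)
  CBwith-elim S X {u} {v} h u∈ v∈ =
    bool (E G u v) (u ∈ᵇ X) (v ∈ᵇ X)
      (⇒-elim (allFin-elim (consistent S X u)
                (allFin-elim (λ u → all (consistent S X u) (allFin (size G))) all-consistent u) v)
        (∧-intro u∈ v∈))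
    where
    all-consistent = proj₂ (∧-elim {any (λ u → (u ∈ᵇ S) ∧ not (u ∈ᵇ X)) (allFin (size G))}
                       (proj₂ (∧-elim {any (λ u → (u ∈ᵇ S) ∧ (u ∈ᵇ X)) (allFin (size G))} h)))
    bool : ∀ e x y → (if e then not (if x then y else not y) else (if x then y else not y)) ≡ true →
      e ≡ (if x then not y else y)
    bool true  true  false _ = refl
    bool true  false true  _ = refl
    bool false true  true  _ = refl
    bool false false false _ = refl

  CBwith-intro : ∀ S X {a b} → a ∈ᵇ S ≡ true → a ∈ᵇ X ≡ true → b ∈ᵇ S ≡ true → b ∈ᵇ X ≡ false →
    (∀ {u v} → u ∈ᵇ S ≡ true → v ∈ᵇ S ≡ true → E G u v ≡ (if u ∈ᵇ X then not (v ∈ᵇ X) else v ∈ᵇ X)) →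
    CBwith G S X ≡ true
  CBwith-intro S X {a} {b} a∈S a∈X b∈S b∉X h =
    ∧-intro (anyFin-intro (λ u → (u ∈ᵇ S) ∧ (u ∈ᵇ X)) a (∧-intro a∈S a∈X))
    (∧-intro (anyFin-intro (λ u → (u ∈ᵇ S) ∧ not (u ∈ᵇ X)) b (∧-intro b∈S (cong not b∉X)))
      (allFin-intro (λ u → all (consistent S X u) (allFin (size G))) λ u → allFin-intro (consistent S X u) λ v →
        ⇒-intro {(u ∈ᵇ S) ∧ (v ∈ᵇ S)} λ p → let u∈ , v∈ = ∧-elim {u ∈ᵇ S} p in
          bool (u ∈ᵇ X) (v ∈ᵇ X) (h u∈ v∈)))
    where
    bool : ∀ {e} x y → e ≡ (if x then not y else y) →
      (if e then not (if x then y else not y) else (if x then y else not y)) ≡ true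
    bool true  true  refl = refl
    bool true  false refl = refl
    bool false true  refl = refl
    bool false false refl = refl

  isCB-elim : ∀ S → isCB G S ≡ true → ∃ λ X → CBwith G S X ≡ true
  isCB-elim S = any-elim (CBwith G S) (allSubsets (size G))

  isBiclique-elim : ∀ S → isBiclique G S ≡ true → isCB G S ≡ true
  isBiclique-elim S h = proj₁ (∧-elim {isCB G S} h)

  isBiclique-lookup : ∀ k → isBiclique G (lookup (bicliques G) k) ≡ true
  isBiclique-lookup k = T⇒ (proj₂
    (∈-filter⁻ (Bool.T? ∘ isBiclique G) {xs = allSubsets (size G)} (∈-lookup {xs = bicliques G} k)))

  bipartition : ∀ k → ∃ λ (X : V G → Bool) →
    ∀ {u v} → u ∈ k → v ∈ k → E G u v ≡ (if X u then not (X v) else X v)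
  bipartition k =
    let S = lookup (bicliques G) k
        X , h = isCB-elim S (isBiclique-elim S (isBiclique-lookup k))
    in (_∈ᵇ X) , CBwith-elim S X h

  no-triangle : ∀ {k u v w} → u ∈ k → v ∈ k → w ∈ k → u ~ v → u ~ w → v ≁ w
  no-triangle {k} {u} {v} {w} u∈ v∈ w∈ uv uw vw = let X , h = bipartition k in
    bool (X u) (X v) (X w)
      (trans (sym (h u∈ v∈)) uv) (trans (sym (h u∈ w∈)) uw) (trans (sym (h v∈ w∈)) vw)
    where
    bool : ∀ x y z → (if x then not y else y) ≡ true → (if x then not z else z) ≡ true →
      (if y then not z else z) ≡ true → ⊥
    bool true  true  _    () _ _
    bool true  false true _ () _
    bool true  false false _ _ ()
    bool false true  true _ _ ()
    bool false true  false _ () _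
    bool false false _    () _ _

  -- The ends of an edge lie on opposite sides, so `w` lies opposite one of them.
  edge-dominates : ∀ {k u v w} → u ∈ k → v ∈ k → w ∈ k → u ~ v → w ~ u ⊎ w ~ v
  edge-dominates {k} {u} {v} {w} u∈ v∈ w∈ uv = let X , h = bipartition k in
    [ inj₁ ∘ trans (h w∈ u∈) , inj₂ ∘ trans (h w∈ v∈) ]′
      (bool (X w) (X u) (X v) (trans (sym (h u∈ v∈)) uv))
    where
    bool : ∀ z x y → (if x then not y else y) ≡ true →
      (if z then not x else x) ≡ true ⊎ (if z then not y else y) ≡ true
    bool true  true  false _ = inj₂ refl
    bool true  false true  _ = inj₁ refl
    bool false true  false _ = inj₁ refl
    bool false false true  _ = inj₂ refl

  isBiclique-refute : ∀ {S} → isCB G S ≡ true → isBiclique G S ≡ false →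
    ∃ λ T → (S ⊆ᵇ T) ∧ not (T ⊆ᵇ S) ∧ isCB G T ≡ true
  isBiclique-refute {S} cb h =
    all-refute (λ T → (S ⊆ᵇ T) ∧ not (T ⊆ᵇ S) ∧ isCB G T) (allSubsets (size G))
      (∧-falseʳ {isCB G S} cb h)

  -- A set that fails maximality has a strictly larger complete bipartite superset. Strict growth
  -- inside a finite vertex set is well-founded, so repeated enlargement ends at a biclique.
  maximal : ∀ {S} → Acc Subset._⊃_ S → isCB G S ≡ true →
    ∃ λ T → isBiclique G T ≡ true × (∀ x → x ∈ᵇ S ≡ true → x ∈ᵇ T ≡ true)
  maximal {S} (acc rec) cb with isBiclique G S Bool.≟ true
  ... | yes bic = S , bic , λ _ x∈ → x∈
  ... | no ¬bic =
    let T , p            = isBiclique-refute {S} cb (¬-not ¬bic)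
        S⊆T , q          = ∧-elim {S ⊆ᵇ T} p
        T⊈S , cbT        = ∧-elim {not (T ⊆ᵇ S)} q
        y , y∈T , y∉S    = ⊈ᵇ-elim T S T⊈S
        S⊂T              = (λ {x} x∈ → lookup⇒[]= x T (⊆ᵇ-elim S T S⊆T x ([]=⇒lookup x∈)))
                         , y , lookup⇒[]= y T y∈T , y∉S ∘ []=⇒lookup
        U , bic , T⊆U    = maximal (rec S⊂T) cbT
    in U , bic , λ x → T⊆U x ∘ ⊆ᵇ-elim S T S⊆T x

  extend : ∀ {S} → isCB G S ≡ true → ∃ λ k → ∀ x → x ∈ᵇ S ≡ true → x ∈ k
  extend {S} cb =
    let T , bic , S⊆T = maximal (⊃-wellFounded S) cb
        T∈ = ∈-filter⁺ (Bool.T? ∘ isBiclique G) (∈-allSubsets T) (⇒T bic)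
    in Any.index T∈ , λ x x∈ → subst (λ R → x ∈ᵇ R ≡ true) (Any.lookup-index T∈) (S⊆T x x∈)

  common : V (KBe G) → V (KBe G) → V G → V G → Bool
  common i j u v = (u ∈ᵇ Bᵢ) ∧ (v ∈ᵇ Bᵢ) ∧ (u ∈ᵇ Bⱼ) ∧ (v ∈ᵇ Bⱼ) ∧ E G u v
    where
    Bᵢ = lookup (bicliques G) i
    Bⱼ = lookup (bicliques G) j

  ~-KBe-intro : ∀ {i j u v} → i ≢ j → u ∈ i → v ∈ i → u ∈ j → v ∈ j → u ~ v → Adj (KBe G) i j
  ~-KBe-intro {i} {j} {u} {v} i≢j ui vi uj vj uv = ∧-intro distinct
    (anyFin-intro (λ u → any (common i j u) (allFin (size G))) u (anyFin-intro (common i j u) v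
      (∧-intro ui (∧-intro vi (∧-intro uj (∧-intro vj uv))))))
    where
    distinct : not (i ≡Fᵇ j) ≡ true
    distinct = cong not (≢⇒≡Fᵇ-false i≢j)

  ~-KBe-elim : ∀ {i j} → Adj (KBe G) i j →
    ∃ λ u → ∃ λ v → u ∈ i × v ∈ i × u ∈ j × v ∈ j × u ~ v
  ~-KBe-elim {i} {j} h =
    let u , h₁  = any-elim (λ u → any (common i j u) (allFin (size G))) (allFin (size G))
                    (proj₂ (∧-elim {not (i ≡Fᵇ j)} h))
        v , h₂  = any-elim (common i j u) (allFin (size G)) h₁
        ui , h₃ = ∧-elim {u ∈ᵇ lookup (bicliques G) i} h₂
        vi , h₄ = ∧-elim {v ∈ᵇ lookup (bicliques G) i} h₃
        uj , h₅ = ∧-elim {u ∈ᵇ lookup (bicliques G) j} h₄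
        vj , uv = ∧-elim {v ∈ᵇ lookup (bicliques G) j} h₅
    in u , v , ui , vi , uj , vj , uv

  KBe-simple : Simple (KBe G)
  KBe-simple = record
    { sym   = λ i j → ⇔⇒≡ {E (KBe G) i j} {E (KBe G) j i} (flip i j) (flip j i)
    ; irref = irrefᴷ
    }
    where
    irrefᴷ : ∀ i → E (KBe G) i i ≡ false
    irrefᴷ i = cong (λ b → not b ∧ shareEdge G (lookup (bicliques G) i) (lookup (bicliques G) i))
      (≡Fᵇ-refl i)
    distinct : ∀ i j → Adj (KBe G) i j → j ≢ i
    distinct i .i h refl = contradiction (trans (sym h) (irrefᴷ i)) λ ()
    flip : ∀ i j → Adj (KBe G) i j → Adj (KBe G) j i
    flip i j h = let u , v , ui , vi , uj , vj , uv = ~-KBe-elim {i} {j} h in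
      ~-KBe-intro {j} {i} (distinct i j h) uj vj ui vi uv

  module _ (simple : Simple G) where
    open Simple simple using (irref)

    ~-sym : ∀ {u v} → u ~ v → v ~ u
    ~-sym = Adj-sym simple _ _

    -- The set with parts {a} and {b, c} is complete bipartite, and `extend` enlarges it to a
    -- biclique.
    star : ∀ {a b c} → a ~ b → a ~ c → b ≁ c → ∃ λ k → a ∈ k × b ∈ k × c ∈ k
    star {a} {b} {c} ab ac b≁c =
      let k , S⊆k = extend {S} (any-intro (CBwith G S) (∈-allSubsets X)
             (CBwith-intro S X (S-intro (inj₁ refl)) (X-true refl) (S-intro (inj₂ (inj₁ refl)))
               (X-false (Adj-irrefl simple _ _ ab ∘ sym)) complete))
      in k , S⊆k a (S-intro (inj₁ refl)) , S⊆k b (S-intro (inj₂ (inj₁ refl))) ,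
             S⊆k c (S-intro (inj₂ (inj₂ refl)))
      where
      InS : V G → Set
      InS x = x ≡ a ⊎ x ≡ b ⊎ x ≡ c
      inS? : ∀ x → Dec (InS x)
      inS? x = (x ≟F a) ⊎-dec (x ≟F b) ⊎-dec (x ≟F c)
      S X : Subset (size G)
      S = tabulate (λ x → does (inS? x))
      X = tabulate (λ x → does (x ≟F a))
      S-intro : ∀ {x} → InS x → x ∈ᵇ S ≡ true
      S-intro {x} p = trans (lookup∘tabulate _ x) (dec-true (inS? x) p)
      S-elim : ∀ {x} → x ∈ᵇ S ≡ true → InS x
      S-elim {x} p = dec-true⁻ (inS? x) (trans (sym (lookup∘tabulate _ x)) p)
      X-true : ∀ {x} → x ≡ a → x ∈ᵇ X ≡ true
      X-true {x} p = trans (lookup∘tabulate _ x) (dec-true (x ≟F a) p)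
      X-false : ∀ {x} → x ≢ a → x ∈ᵇ X ≡ false
      X-false {x} p = trans (lookup∘tabulate _ x) (dec-false (x ≟F a) p)
      Leaf : V G → Set
      Leaf x = x ≡ b ⊎ x ≡ c
      centre~leaf : ∀ {x} → Leaf x → a ~ x
      centre~leaf (inj₁ refl) = ab
      centre~leaf (inj₂ refl) = ac
      leaf≁leaf : ∀ {x y} → Leaf x → Leaf y → E G x y ≡ false
      leaf≁leaf (inj₁ refl) (inj₁ refl) = irref b
      leaf≁leaf (inj₁ refl) (inj₂ refl) = ¬-not b≁c
      leaf≁leaf (inj₂ refl) (inj₁ refl) = ¬-not (b≁c ∘ ~-sym)
      leaf≁leaf (inj₂ refl) (inj₂ refl) = irref c
      X-leaf : ∀ {x} → Leaf x → x ∈ᵇ X ≡ false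
      X-leaf l = X-false (Adj-irrefl simple _ _ (centre~leaf l) ∘ sym)
      complete : ∀ {u v} → u ∈ᵇ S ≡ true → v ∈ᵇ S ≡ true →
        E G u v ≡ (if u ∈ᵇ X then not (v ∈ᵇ X) else v ∈ᵇ X)
      complete {u} {v} u∈ v∈ with S-elim u∈ | S-elim v∈
      ... | inj₁ refl | inj₁ refl rewrite X-true {a} refl = irref a
      ... | inj₁ refl | inj₂ l    rewrite X-true {a} refl | X-leaf l = centre~leaf l
      ... | inj₂ l    | inj₁ refl rewrite X-true {a} refl | X-leaf l = ~-sym (centre~leaf l)
      ... | inj₂ l    | inj₂ l′   rewrite X-leaf l | X-leaf l′ = leaf≁leaf l l′

-- Interface between a graph and its edge-biclique graph

-- All that is needed of H = KBe G.  Maximality of bicliques enters only through star.  Keeping H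
-- a variable prevents the type checker from unfolding the edges of KBe.
record EdgeBiclique (G H : Graph) : Set₁ where
  no-eta-equality

  infix 4 _∈_

  field
    G-simple       : Simple G
    H-simple       : Simple H
    _∈_            : V G → V H → Set
    no-triangle    : ∀ {k u v w} → u ∈ k → v ∈ k → w ∈ k → Adj G u v → Adj G u w → ¬ Adj G v w
    edge-dominates : ∀ {k u v w} → u ∈ k → v ∈ k → w ∈ k → Adj G u v → Adj G w u ⊎ Adj G w v
    star           : ∀ {a b c} → Adj G a b → Adj G a c → ¬ Adj G b c → ∃ λ k → a ∈ k × b ∈ k × c ∈ k
    ~-intro        : ∀ {k l u v} → k ≢ l → u ∈ k → v ∈ k → u ∈ l → v ∈ l → Adj G u v → Adj H k l
    ~-elim         : ∀ {k l} → Adj H k l →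
                     ∃ λ u → ∃ λ v → u ∈ k × v ∈ k × u ∈ l × v ∈ l × Adj G u v

  ~sym : ∀ {u v} → Adj G u v → Adj G v u
  ~sym = Adj-sym G-simple _ _

  -- Nonadjacent members of a biclique lie on one side and so have the same neighbours in it. This
  -- usually supplies the second adjacency needed to apply good neighbours.
  same-side : ∀ {k u v w} → u ∈ k → v ∈ k → w ∈ k → ¬ Adj G u v → Adj G u w → Adj G v w
  same-side u∈ v∈ w∈ u≁v u~w =
    [ (λ v~u → contradiction (~sym v~u) u≁v) , (λ v~w → v~w) ]′ (edge-dominates u∈ w∈ v∈ u~w)

KBe-edgeBiclique : ∀ {G} → Simple G → EdgeBiclique G (KBe G)
KBe-edgeBiclique {G} simple = λ where
    .G-simple           → simple
    .H-simple           → KBe-simple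
    ._∈_                → Biclique._∈_ G
    .no-triangle {k}    → Biclique.no-triangle G {k}
    .edge-dominates {k} → Biclique.edge-dominates G {k}
    .star               → Biclique.star G simple
    .~-intro            → ~-KBe-intro
    .~-elim {k} {l}     → ~-KBe-elim {k} {l}
  where
  open Biclique G using (KBe-simple; ~-KBe-intro; ~-KBe-elim)
  open EdgeBiclique

KBe^-edgeBiclique : ∀ {G} → Simple G → ∀ k → EdgeBiclique (KBe^ k G) (KBe^ (suc k) G)
KBe^-edgeBiclique simple zero    = KBe-edgeBiclique simple
KBe^-edgeBiclique simple (suc k) =
  KBe-edgeBiclique (EdgeBiclique.H-simple (KBe^-edgeBiclique simple k))

-- Good cycles and vertices on their edges

-- A fixed point of `s` or `s²` is one of `s⁴`, so the two inequalities exclude all cycle lengths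
-- from 1 to 4.
module Cyclic {I : Set} (s : I → I) (s-injective : ∀ {i j} → s i ≡ s j → i ≡ j)
  (s³≢ : ∀ i → s (s (s i)) ≢ i) (s⁴≢ : ∀ i → s (s (s (s i))) ≢ i) where

  s² s³ s⁴ : I → I
  s² i = s (s i)
  s³ i = s (s² i)
  s⁴ i = s (s³ i)

  s²≢ : ∀ i → s² i ≢ i
  s²≢ i eq = s⁴≢ i (trans (cong s² eq) eq)

  s≢ : ∀ i → s i ≢ i
  s≢ i eq = s²≢ i (trans (cong s eq) eq)

  -- `c-adj⁻¹` makes the cycle induced. The first alternative in `good` lets `v` range over the
  -- cycle as well, which spares later arguments a case distinction.
  record GoodCycle (G : Graph) : Set where
    no-eta-equality
    field
      simple  : Simple G
      c       : I → V G
      c-inj   : ∀ {i j} → c i ≡ c j → i ≡ j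
      c-adj   : ∀ i → Adj G (c i) (c (s i))
      c-adj⁻¹ : ∀ {i j} → Adj G (c i) (c j) → j ≡ s i ⊎ i ≡ s j
      good    : ∀ {v} i → Adj G v (c i) → Adj G v (c (s² i)) → v ≡ c (s i) ⊎ Adj G v (c (s i))

    chord₂ : ∀ {i} → ¬ Adj G (c i) (c (s² i))
    chord₂ {i} h with c-adj⁻¹ h
    ... | inj₁ e = s≢ (s i) e
    ... | inj₂ e = s³≢ i (sym e)

    chord₃ : ∀ {i} → ¬ Adj G (c i) (c (s³ i))
    chord₃ {i} h with c-adj⁻¹ h
    ... | inj₁ e = s²≢ (s i) e
    ... | inj₂ e = s⁴≢ i (sym e)

  -- u is on the edge {s i, s² i}; indexing it by i avoids the predecessor of an index.
  record On {G} (C : GoodCycle G) (i : I) (u : V G) : Set where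
    constructor on
    open GoodCycle C
    field
      u≁0 : ¬ Adj G u (c i)
      u~1 : Adj G u (c (s i))
      u~2 : Adj G u (c (s² i))
      u≁3 : ¬ Adj G u (c (s³ i))

  -- The bicliques along a good cycle form a good cycle

  module Step {G H} (C : GoodCycle G) (K : EdgeBiclique G H) where
    open GoodCycle C
    open EdgeBiclique K
    open Adjacency G

    star-at : ∀ i → ∃ λ k → c (s i) ∈ k × c i ∈ k × c (s² i) ∈ k
    star-at i = star (~sym (c-adj i)) (c-adj (s i)) chord₂

    B : I → V H
    B i = proj₁ (star-at i)

    0∈B : ∀ {i} → c i ∈ B i
    0∈B {i} = proj₁ (proj₂ (proj₂ (star-at i)))

    1∈B : ∀ {i} → c (s i) ∈ B i
    1∈B {i} = proj₁ (proj₂ (star-at i))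

    2∈B : ∀ {i} → c (s² i) ∈ B i
    2∈B {i} = proj₂ (proj₂ (proj₂ (star-at i)))

    -- The edge from `c i` to `c (s i)` would dominate the fourth vertex, which gives a chord of the
    -- cycle.
    no-path₄ : ∀ {k} i → c i ∈ k → c (s i) ∈ k → c (s² i) ∈ k → ¬ c (s³ i) ∈ k
    no-path₄ i v0 v1 v2 v3 =
      [ chord₂ ∘ ~sym , chord₃ ∘ ~sym ]′ (swap (edge-dominates v0 v1 v3 (c-adj i)))

    B-star : ∀ {x} i → x ∈ B i → x ≡ c (s i) ⊎ x ~ c (s i)
    B-star i x∈ with edge-dominates 0∈B 1∈B x∈ (c-adj i)
    ... | inj₂ x~1 = inj₂ x~1
    ... | inj₁ x~0 = good i x~0 (~sym (same-side 0∈B 2∈B x∈ chord₂ (~sym x~0)))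

    -- Every edge of the star `B i` contains its centre, since two adjacent leaves would form a
    -- triangle with it. The witness `x` is the other end of a shared edge.
    ~B⇒centre∈ : ∀ {k} i → Adj H k (B i) → c (s i) ∈ k × ∃ λ x → x ∈ k × x ∈ B i × x ~ c (s i)
    ~B⇒centre∈ i h with x , y , xk , yk , xB , yB , x~y ← ~-elim h
      with B-star i xB | B-star i yB
    ... | inj₁ refl | _         = xk , y , yk , yB , ~sym x~y
    ... | inj₂ x~1  | inj₁ refl = yk , x , xk , xB , x~1
    ... | inj₂ x~1  | inj₂ y~1  = ⊥-elim (no-triangle 1∈B xB yB (~sym x~1) (~sym y~1) x~y)

    B-adj : ∀ i → Adj H (B i) (B (s i))
    B-adj i = ~-intro distinct 1∈B 2∈B 0∈B 1∈B (c-adj (s i))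
      where
      distinct : B i ≢ B (s i)
      distinct eq = no-path₄ i 0∈B 1∈B 2∈B (subst (c (s³ i) ∈_) (sym eq) 2∈B)

    B≢B⁺ : ∀ i → B i ≢ B (s i)
    B≢B⁺ i = Adj-irrefl H-simple _ _ (B-adj i)

    -- The centre of `B i` lies in `B j`, so the two centres are equal or adjacent. Adjacent centres
    -- belong to consecutive bicliques, which `B-adj` keeps distinct.
    B-inj : ∀ {i j} → B i ≡ B j → i ≡ j
    B-inj {i} {j} eq with B-star j (subst (c (s i) ∈_) eq 1∈B)
    ... | inj₁ e = s-injective (c-inj e)
    ... | inj₂ h with c-adj⁻¹ h
    ...   | inj₁ e = ⊥-elim (B≢B⁺ i (trans eq (cong B (s-injective e))))
    ...   | inj₂ e = ⊥-elim (B≢B⁺ j (trans (sym eq) (cong B (s-injective e))))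

    B-adj⁻¹ : ∀ {i j} → Adj H (B i) (B j) → j ≡ s i ⊎ i ≡ s j
    B-adj⁻¹ {i} {j} h with B-star i (proj₁ (~B⇒centre∈ j h))
    ... | inj₁ e  = ⊥-elim (Adj-irrefl H-simple _ _ h (cong B (s-injective (c-inj (sym e)))))
    ... | inj₂ h′ = [ inj₂ ∘ s-injective , inj₁ ∘ s-injective ]′ (c-adj⁻¹ h′)

    -- The biclique `k` contains the centres `c (s i)` and `c (s³ i)`, on one side, so the vertex
    -- `x` that it shares with `B i` is adjacent to both. Good neighbours and the absence of
    -- triangles in `B i` force `x` to be `c (s² i)`; hence `k` contains an edge of `B (s i)`.
    B-good : ∀ {k} i → Adj H k (B i) → Adj H k (B (s² i)) →
      k ≡ B (s i) ⊎ Adj H k (B (s i))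
    B-good {k} i h₀ h₂
      with 1∈k , x , x∈k , x∈B , x~1 ← ~B⇒centre∈ i h₀
      with 3∈k , _ ← ~B⇒centre∈ (s² i) h₂
      with good (s i) x~1 (~sym (same-side 1∈k 3∈k x∈k chord₂ (~sym x~1)))
    ... | inj₂ x~2 = ⊥-elim (no-triangle x∈B 1∈B 2∈B x~1 x~2 (c-adj (s i)))
    ... | inj₁ refl with k ≟F B (s i)
    ...   | yes e = inj₁ e
    ...   | no k≢ = inj₂ (~-intro k≢ 1∈k x∈k 0∈B 1∈B (c-adj (s i)))

  next : ∀ {G H} → GoodCycle G → EdgeBiclique G H → GoodCycle H
  next C K .GoodCycle.simple  = EdgeBiclique.H-simple K
  next C K .GoodCycle.c       = Step.B C K
  next C K .GoodCycle.c-inj   = Step.B-inj C K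
  next C K .GoodCycle.c-adj   = Step.B-adj C K
  next C K .GoodCycle.c-adj⁻¹ = Step.B-adj⁻¹ C K
  next C K .GoodCycle.good    = Step.B-good C K

  -- Passing vertices on an edge to the next graph

  module Through {G H} (C : GoodCycle G) (K : EdgeBiclique G H) where
    open GoodCycle C
    open EdgeBiclique K
    open Adjacency G
    open Step C K

    -- On (next C K) expressed by membership; B i is centred at s i, whence the shift by one.
    record Thru (i : I) (k : V H) : Set where
      constructor thru
      field
        ∌1 : ¬ c (s i) ∈ k
        ∋2 : c (s² i) ∈ k
        ∋3 : c (s³ i) ∈ k
        ∌4 : ¬ c (s⁴ i) ∈ k

    Thru⇒On : ∀ {i k} → Thru i k → On (next C K) i k
    Thru⇒On {i} {k} (thru ∌1 ∋2 ∋3 ∌4) = on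
      (∌1 ∘ proj₁ ∘ ~B⇒centre∈ i)
      (~-intro (λ { refl → ∌1 0∈B }) ∋2 ∋3 1∈B 2∈B (c-adj (s² i)))
      (~-intro (λ { refl → ∌4 2∈B }) ∋2 ∋3 0∈B 1∈B (c-adj (s² i)))
      (∌4 ∘ proj₁ ∘ ~B⇒centre∈ (s³ i))

    -- A further cycle vertex in `k` would give it an edge of `B i` or of `B (s³ i)`. Equality with
    -- either biclique is excluded by `no-path₄`.
    On⇒Thru : ∀ {i k} → On (next C K) i k → Thru i k
    On⇒Thru {i} {k} (on ≁0 ~1 ~2 ≁3) = thru
      (λ ∋1 → ≁0 (~-intro (λ { refl → no-path₄ i 0∈B 1∈B 2∈B ∋3 }) ∋1 ∋2 1∈B 2∈B (c-adj (s i))))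
      ∋2 ∋3
      (λ ∋4 → ≁3 (~-intro (λ { refl → no-path₄ (s² i) ∋2 0∈B 1∈B 2∈B }) ∋3 ∋4 0∈B 1∈B (c-adj (s³ i))))
      where
      ∋2 = proj₁ (~B⇒centre∈ (s i) ~1)
      ∋3 = proj₁ (~B⇒centre∈ (s² i) ~2)

    -- All these bicliques contain the edge from `c (s² i)` to `c (s³ i)`.
    On-clique : ∀ {i k l} → On (next C K) i k → On (next C K) i l → k ≢ l → Adj H k l
    On-clique {i} {k} {l} p q k≢l = ~-intro k≢l (∋2 k′) (∋3 k′) (∋2 l′) (∋3 l′) (c-adj (s² i))
      where
      open Thru
      k′ = On⇒Thru p
      l′ = On⇒Thru q

    -- Any biclique extending the star at `c (s² i)` with leaves `c (s³ i)` and `u` will do: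
    -- `c (s i)` would close a triangle with `u` and the centre, and `c (s⁴ i)` would be adjacent to
    -- `u`, against good neighbours at `c (s³ i)`. The index stays `i` because `B i` is centred at
    -- `s i`.
    forward : ∀ {i u} → On C i u → ∃ λ k → On (next C K) i k × u ∈ k
    forward {i} {u} (on ≁0 ~1 ~2 ≁3)
      with k , 2∈k , 3∈k , u∈k ← star (c-adj (s² i)) (~sym ~2) (≁3 ∘ ~sym) =
      k , Thru⇒On (thru
        (λ 1∈k → no-triangle u∈k 1∈k 2∈k ~1 ~2 (c-adj (s i)))
        2∈k 3∈k
        λ 4∈k → [ (λ { refl → chord₂ (~sym ~1) }) , ≁3 ]′
          (good (s² i) ~2 (same-side 3∈k u∈k 4∈k (≁3 ∘ ~sym) (c-adj (s³ i))))) , u∈k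

    -- The mirror image of `forward`, with centre `c (s³ i)` and leaves `c (s² i)` and `u`. The
    -- shift of centres turns one edge backwards into a drop of the index by two.
    backward : ∀ {i u} → On C (s² i) u → ∃ λ k → On (next C K) i k × u ∈ k
    backward {i} {u} (on ≁2 ~3 ~4 ≁5)
      with k , 3∈k , 2∈k , u∈k ← star (~sym (c-adj (s² i))) (~sym ~3) (≁2 ∘ ~sym) =
      k , Thru⇒On (thru
        (λ 1∈k → [ (λ { refl → chord₂ ~4 }) , ≁2 ]′
          (good (s i) (same-side 2∈k u∈k 1∈k (≁2 ∘ ~sym) (~sym (c-adj (s i)))) ~3))
        2∈k 3∈k
        λ 4∈k → no-triangle u∈k 3∈k 4∈k ~3 ~4 (c-adj (s³ i))) , u∈k

  -- Nonadjacency across edges at distance one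

  module Twice {G H L} (C : GoodCycle G) (K : EdgeBiclique G H) (K′ : EdgeBiclique H L) where
    open GoodCycle C
    private
      module H = EdgeBiclique K′
      module C′ = GoodCycle (next C K)
    open EdgeBiclique K
    open Adjacency G using (_~_)
    open Adjacency H using () renaming (_~_ to _~′_; _≁_ to _≁′_)
    open Step C K
    open Through C K

    -- Here `x` contains the middle edge of the path from `c (s i)` to `c (s⁴ i)`, while `y`
    -- contains only the two ends of that path. An edge shared by `x` and `y` has one end adjacent
    -- to `c (s² i)` and the other to `c (s³ i)`. Since `c (s i)` and `c (s⁴ i)` lie on one side of
    -- `y`, one of these ends meets good neighbours at the middle vertex that it is not adjacent to.
    no-crossing : ∀ {x y} i → On (next C K) i x →
      y ~′ B i → y ≁′ B (s i) → y ≁′ B (s² i) → y ~′ B (s³ i) → x ≁′ y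
    no-crossing {x} {y} i on-x y~B₀ y≁B₁ y≁B₂ y~B₃ x~y
      with z , t , z∈x , t∈x , z∈y , t∈y , z~t ← ~-elim x~y =
      -- If `z` is adjacent to `c (s² i)`, then `t` must be adjacent to `c (s³ i)`, and `absurd`
      -- applies with the two ends exchanged.
      [ (λ z~2 → [ no-triangle z∈x t∈x 2∈x z~t z~2 , absurd t∈x z∈x t∈y z∈y (~sym z~t) ]′
                   (edge-dominates 2∈x 3∈x t∈x (c-adj (s² i))))
      , absurd z∈x t∈x z∈y t∈y z~t
      ]′ (edge-dominates 2∈x 3∈x z∈x (c-adj (s² i)))
      where
      open Thru (On⇒Thru on-x) renaming (∋2 to 2∈x; ∋3 to 3∈x)
      1∈y : c (s i) ∈ y
      1∈y = proj₁ (~B⇒centre∈ i y~B₀)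
      4∈y : c (s⁴ i) ∈ y
      4∈y = proj₁ (~B⇒centre∈ (s³ i) y~B₃)
      2∉y : ¬ c (s² i) ∈ y
      2∉y 2∈y = y≁B₁ (~-intro (λ { refl → y≁B₂ (B-adj (s i)) }) 1∈y 2∈y 0∈B 1∈B (c-adj (s i)))
      3∉y : ¬ c (s³ i) ∈ y
      3∉y 3∈y = y≁B₂ (~-intro
        (λ { refl → y≁B₁ (H.~sym (B-adj (s i))) })
        3∈y 4∈y 1∈B 2∈B (c-adj (s³ i)))
      absurd : ∀ {z t} → z ∈ x → t ∈ x → z ∈ y → t ∈ y → z ~ t → ¬ z ~ c (s³ i)
      absurd {z} {t} z∈x t∈x z∈y t∈y z~t z~3 =
        [ (λ 1~z → [ (λ { refl → 2∉y z∈y })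
                   , (λ z~2 → no-triangle z∈x 2∈x 3∈x z~2 z~3 (c-adj (s² i)))
                   ]′ (good (s i) (~sym 1~z) z~3))
        , (λ 1~t → [ (λ { refl → 3∉y t∈y }) , t≁3 ]′
                     (good (s² i) t~2 (~sym (same-side 1∈y 4∈y t∈y chord₃ 1~t))))
        ]′ (edge-dominates z∈y t∈y 1∈y z~t)
        where
        t≁3 : ¬ t ~ c (s³ i)
        t≁3 = no-triangle z∈x t∈x 3∈x z~t z~3
        t~2 : t ~ c (s² i)
        t~2 = [ (λ h → h) , ⊥-elim ∘ t≁3 ]′ (edge-dominates 2∈x 3∈x t∈x (c-adj (s² i)))

    -- An edge shared by `u` and `w` is dominated by consecutive cycle vertices on either side: one
    -- end is adjacent to `B (s³ i)` and `B (s⁴ i)` only, the other to `B (s² i)` and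
    -- `B (s² (s³ i))` only, among these four. Such an edge is what `no-crossing` forbids one level
    -- below.
    On-nonadjacent : ∀ {i u w} → On (next (next C K) K′) i u → On (next (next C K) K′) (s² i) w →
      ¬ Adj L u w
    On-nonadjacent {i} {u} {w} on-u on-w u~w
      with x , y , x∈u , y∈u , x∈w , y∈w , x~y ← H.~-elim u~w =
      [ (λ x~2 → [ H.no-triangle x∈u y∈u ∋2 x~y x~2
                 , absurd y∈u x∈u y∈w x∈w (H.~sym x~y) ]′
                   (H.edge-dominates ∋2 ∋3 y∈u (C′.c-adj (s² i))))
      , absurd x∈u y∈u x∈w y∈w x~y
      ]′ (H.edge-dominates ∋2 ∋3 x∈u (C′.c-adj (s² i)))
      where
      module T′ = Through (next C K) K′
      open T′.Thru (T′.On⇒Thru on-u)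
      open T′.Thru (T′.On⇒Thru on-w) using () renaming (∋2 to 4∈w; ∋3 to 5∈w)
      absurd : ∀ {x y} → x H.∈ u → y H.∈ u → x H.∈ w → y H.∈ w → x ~′ y → ¬ x ~′ B (s³ i)
      absurd {x} {y} x∈u y∈u x∈w y∈w x~y x~3 =
        no-crossing (s² i) (on x≁2 x~3 x~4 x≁5) y~2 y≁3 y≁4 y~5 x~y
        where
        x≁2 : x ≁′ B (s² i)
        x≁2 x~2 = H.no-triangle x∈u ∋2 ∋3 x~2 x~3 (C′.c-adj (s² i))
        x≁5 : x ≁′ B (s² (s³ i))
        x≁5 x~5 = [ (λ { refl → ∌4 x∈u })
                  , (λ x~4 → H.no-triangle x∈w 4∈w 5∈w x~4 x~5 (C′.c-adj (s⁴ i)))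
                  ]′ (C′.good (s³ i) x~3 x~5)
        x~4 : x ~′ B (s⁴ i)
        x~4 = [ (λ h → h) , ⊥-elim ∘ x≁5 ]′ (H.edge-dominates 4∈w 5∈w x∈w (C′.c-adj (s⁴ i)))
        y≁3 : y ≁′ B (s³ i)
        y≁3 = H.no-triangle x∈u y∈u ∋3 x~y x~3
        y~2 : y ~′ B (s² i)
        y~2 = [ (λ h → h) , ⊥-elim ∘ y≁3 ]′ (H.edge-dominates ∋2 ∋3 y∈u (C′.c-adj (s² i)))
        y≁4 : y ≁′ B (s⁴ i)
        y≁4 = H.no-triangle x∈w y∈w 4∈w x~y x~4
        y~5 : y ~′ B (s² (s³ i))
        y~5 = [ ⊥-elim ∘ y≁4 , (λ h → h) ]′ (H.edge-dominates 4∈w 5∈w y∈w (C′.c-adj (s⁴ i)))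

  -- Growing families and divergence

  -- The vertex `other` is the reservoir: `backward` turns it into a new member, while `forward`
  -- keeps it at its index for the next step.
  record Family {G} (C : GoodCycle G) (i : I) (a : ℕ) : Set where
    field
      member    : Fin a → V G
      injective : Injective _≡_ _≡_ member
      member-on : ∀ x → On C i (member x)
      other     : V G
      other-on  : On C (s² i) other

  module Growth {G H} (C : GoodCycle G) (K : EdgeBiclique G H)
    (clique      : ∀ {i u v} → On C i u → On C i v → u ≢ v → Adj G u v)
    (nonadjacent : ∀ {i u v} → On C i u → On C (s² i) v → ¬ Adj G u v) where
    open GoodCycle C using (c)
    open EdgeBiclique K
    open Through C K

    grow : ∀ {i a} → Family C i a → Family (next C K) i (suc a)
    grow {i} {a} F = record
      { member = new ; injective = new-injective ; member-on = new-on
      ; other = proj₁ (forward other-on) ; other-on = proj₁ (proj₂ (forward other-on)) }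
      where
      open Family F
      new : Fin (suc a) → V H
      new zero    = proj₁ (backward other-on)
      new (suc x) = proj₁ (forward (member-on x))
      new-on : ∀ x → On (next C K) i (new x)
      new-on zero    = proj₁ (proj₂ (backward other-on))
      new-on (suc x) = proj₁ (proj₂ (forward (member-on x)))
      -- In a common biclique the old member would lie on the side of `c (s³ i)`, to which `other`
      -- is adjacent, and so would be adjacent to `other`.
      old≢new : ∀ x → new (suc x) ≢ new zero
      old≢new x eq = nonadjacent (member-on x) other-on
        (same-side (Thru.∋3 (On⇒Thru (new-on zero)))
          (subst (member x ∈_) eq (proj₂ (proj₂ (forward (member-on x)))))
          (proj₂ (proj₂ (backward other-on)))
          (On.u≁3 (member-on x) ∘ ~sym)
          (~sym (On.u~1 other-on)))
      new-injective : Injective _≡_ _≡_ new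
      new-injective {zero}  {zero}  _  = refl
      new-injective {zero}  {suc y} eq = ⊥-elim (old≢new y (sym eq))
      new-injective {suc x} {zero}  eq = ⊥-elim (old≢new x eq)
      new-injective {suc x} {suc y} eq with x ≟F y
      ... | yes refl = refl
      -- Two distinct members in one biclique would form a triangle with `c (s² i)`.
      ... | no x≢y = ⊥-elim (no-triangle
              (proj₂ (proj₂ (forward (member-on x))))
              (subst (member y ∈_) (sym eq) (proj₂ (proj₂ (forward (member-on y)))))
              (Thru.∋2 (On⇒Thru (new-on (suc x))))
              (clique (member-on x) (member-on y) (x≢y ∘ injective))
              (On.u~2 (member-on x)) (On.u~2 (member-on y)))

  module Iteration (Γ : ℕ → Graph) (K : ∀ k → EdgeBiclique (Γ k) (Γ (suc k)))
    (C : GoodCycle (Γ 0)) where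

    cycle : ∀ k → GoodCycle (Γ k)
    cycle zero    = C
    cycle (suc k) = next (cycle k) (K k)

    -- The count starts with an empty family at the second iterate, since `On-nonadjacent` needs two
    -- preceding steps; `forward` carries the initial vertex there.
    family : ∀ {i u} → On C (s² i) u → ∀ k → Family (cycle (2 + k)) i k
    family u-on zero =
      let v , v-on , _ = Through.forward C (K 0) u-on
          w , w-on , _ = Through.forward (cycle 1) (K 1) v-on
      in record { member = λ () ; injective = λ { {()} } ; member-on = λ () ; other = w ; other-on = w-on }
    family u-on (suc k) =
      Growth.grow (cycle (2 + k)) (K (2 + k))
        (Through.On-clique (cycle (1 + k)) (K (1 + k)))
        (Twice.On-nonadjacent (cycle k) (K k) (K (1 + k)))
        (family u-on k)

    size-grows : ∀ {i u} → On C (s² i) u → ∀ k → k ≤ size (Γ (2 + k))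
    size-grows u-on k = injective⇒≤ (Family.injective (family u-on k))

  diverges : ∀ {G} (C : GoodCycle G) {i u} → On C (s² i) u → Diverges G
  diverges {G} C u-on N = 2 + N , λ { (suc (suc k)) (s≤s (s≤s N≤k)) →
    ≤-trans N≤k (Iteration.size-grows (λ k → KBe^ k G) (KBe^-edgeBiclique (GoodCycle.simple C)) C u-on k) }

-- Rotation of the cyclic indices

module Rotation (n : ℕ) .{{_ : NonZero n}} (5≤n : 5 ≤ n) where

  s : Fin n → Fin n
  s i = suc (toℕ i) mod n

  toℕ-s : ∀ i → toℕ (s i) ≡ suc (toℕ i) % n
  toℕ-s i = toℕ-fromℕ< (m%n<n (suc (toℕ i)) n)

  s-step : ∀ i → suc (toℕ i) < n → toℕ (s i) ≡ suc (toℕ i)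
  s-step i lt = trans (toℕ-s i) (m<n⇒m%n≡m lt)

  s-wrap : ∀ i → suc (toℕ i) ≡ n → toℕ (s i) ≡ 0
  s-wrap i eq = trans (toℕ-s i) (trans (cong (_% n) eq) (n%n≡0 n))

  s-cases : ∀ i → (suc (toℕ i) < n × toℕ (s i) ≡ suc (toℕ i)) ⊎ (suc (toℕ i) ≡ n × toℕ (s i) ≡ 0)
  s-cases i = [ (λ lt → inj₁ (lt , s-step i lt)) , (λ eq → inj₂ (eq , s-wrap i eq)) ]′
    (m≤n⇒m<n∨m≡n (toℕ<n i))

  s-injective : ∀ {i j} → s i ≡ s j → i ≡ j
  s-injective {i} {j} eq with s-cases i | s-cases j | cong toℕ eq
  ... | inj₁ (_ , p) | inj₁ (_ , q) | e = toℕ-injective (suc-injective (trans (sym p) (trans e q)))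
  ... | inj₁ (_ , p) | inj₂ (_ , q) | e = contradiction (trans (sym p) (trans e q)) λ ()
  ... | inj₂ (_ , p) | inj₁ (_ , q) | e = contradiction (trans (sym p) (trans e q)) λ ()
  ... | inj₂ (p , _) | inj₂ (q , _) | _ = toℕ-injective (suc-injective (trans p (sym q)))

  suc-% : ∀ m → suc (m % n) % n ≡ suc m % n
  suc-% m = trans (%-distribˡ-+ 1 (m % n) n)
    (trans (cong (λ x → (1 % n + x) % n) (m%n%n≡m%n m n)) (sym (%-distribˡ-+ 1 m n)))

  toℕ-s-+ : ∀ {i} k {t} → toℕ i ≡ (k + t) % n → toℕ (s i) ≡ (suc k + t) % n
  toℕ-s-+ {i} k eq = trans (toℕ-s i) (trans (cong (λ x → suc x % n) eq) (suc-% _))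

  -- The sum is below 2n, so reduction subtracts `n` at most once. Without a subtraction the result
  -- exceeds `t`; with one, equality to `t` would force `suc k` to be `n`.
  no-fixed-point : ∀ k t → t < n → suc k < n → (suc k + t) % n ≢ t
  no-fixed-point k t t<n k<n eq with suc k + t <? n
  ... | yes lt = m≢1+n+m t (trans (sym eq) (m<n⇒m%n≡m lt))
  ... | no  ≮n = <-irrefl (+-cancelʳ-≡ t (suc k) n k+t≡n+t) k<n
    where
    n≤ = ≮⇒≥ ≮n
    <n : suc k + t ∸ n < n
    <n = +-cancelʳ-< n _ _ (subst (_< n + n) (sym (m∸n+n≡m n≤)) (+-mono-< k<n t<n))
    k+t≡n+t : suc k + t ≡ n + t
    k+t≡n+t = trans (sym (m∸n+n≡m n≤)) (trans (cong (_+ n)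
      (trans (sym (m<n⇒m%n≡m <n)) (trans (m≤n⇒[n∸m]%m≡n%m n≤) eq))) (+-comm t n))

  toℕ-s³ : ∀ i → toℕ (s (s (s i))) ≡ (3 + toℕ i) % n
  toℕ-s³ i = toℕ-s-+ 2 (toℕ-s-+ 1 (toℕ-s i))

  s³≢ : ∀ i → s (s (s i)) ≢ i
  s³≢ i eq = no-fixed-point 2 (toℕ i) (toℕ<n i) (≤-trans (n≤1+n 4) 5≤n)
    (trans (sym (toℕ-s³ i)) (cong toℕ eq))

  s⁴≢ : ∀ i → s (s (s (s i))) ≢ i
  s⁴≢ i eq = no-fixed-point 3 (toℕ i) (toℕ<n i) 5≤n
    (trans (sym (toℕ-s-+ 3 (toℕ-s³ i))) (cong toℕ eq))

  ≡ᵇ-intro : ∀ {a b} → a ≡ b → (a ≡ᵇ b) ≡ true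
  ≡ᵇ-intro {a} {b} eq = T⇒ (≡⇒≡ᵇ a b eq)

  ≡ᵇ-elim : ∀ {a b} → (a ≡ᵇ b) ≡ true → a ≡ b
  ≡ᵇ-elim {a} {b} eq = ≡ᵇ⇒≡ a b (⇒T eq)

  succᵇ-s : ∀ i → succᵇ n i (s i) ≡ true
  succᵇ-s i with s-cases i
  ... | inj₁ (_ , p) = ∨-introˡ (≡ᵇ-intro (sym p))
  ... | inj₂ (p , q) = ∨-introʳ {suc (toℕ i) ≡ᵇ toℕ (s i)} (∧-intro (≡ᵇ-intro p) (≡ᵇ-intro q))

  succᵇ⇒s : ∀ i j → succᵇ n i j ≡ true → j ≡ s i
  succᵇ⇒s i j h with suc (toℕ i) ≡ᵇ toℕ j in eq
  ... | true  = toℕ-injective (trans (sym p) (sym (s-step i (subst (_< n) (sym p) (toℕ<n j)))))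
    where p = ≡ᵇ-elim eq
  ... | false = let p , q = ∧-elim {suc (toℕ i) ≡ᵇ n} h in
    toℕ-injective (trans (≡ᵇ-elim q) (sym (s-wrap i (≡ᵇ-elim p))))

  open Cyclic s s-injective s³≢ s⁴≢ public

  -- The good cycle and the clique of a necklace

  module _ (G : Graph) (simple : Simple G) (m : ℕ) (f : V (Necklace n m) → V G)
    (embedding : InducedEmbedding (Necklace n m) G f)
    (good : GoodNeighbors G n (λ i → f (i ↑ˡ m))) where

    c : Fin n → V G
    c i = f (i ↑ˡ m)

    E-cycle : ∀ i j → E G (c i) (c j) ≡ succᵇ n i j ∨ succᵇ n j i
    E-cycle i j = trans (sym (proj₂ embedding (i ↑ˡ m) (j ↑ˡ m))) necklace
      where
      necklace : necklaceAdj n m (i ↑ˡ m) (j ↑ˡ m) ≡ succᵇ n i j ∨ succᵇ n j i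
      necklace rewrite splitAt-↑ˡ n i m | splitAt-↑ˡ n j m = refl

    E-apex : ∀ a i → E G (f (n ↑ʳ a)) (c i) ≡ (toℕ i <ᵇ 2)
    E-apex a i = trans (sym (proj₂ embedding (n ↑ʳ a) (i ↑ˡ m))) necklace
      where
      necklace : necklaceAdj n m (n ↑ʳ a) (i ↑ˡ m) ≡ (toℕ i <ᵇ 2)
      necklace rewrite splitAt-↑ʳ n m a | splitAt-↑ˡ n i m = refl

    c-adj⁻¹ : ∀ {i j} → Adj G (c i) (c j) → j ≡ s i ⊎ i ≡ s j
    c-adj⁻¹ {i} {j} h with succᵇ n i j in eq | trans (sym (E-cycle i j)) h
    ... | true  | _ = inj₁ (succᵇ⇒s i j eq)
    ... | false | p = inj₂ (succᵇ⇒s j i p)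

    good-cycle : GoodCycle G
    good-cycle = record
      { simple  = simple
      ; c       = c
      ; c-inj   = ↑ˡ-injective m _ _ ∘ proj₁ embedding
      ; c-adj   = λ i → trans (E-cycle i (s i)) (∨-introˡ (succᵇ-s i))
      ; c-adj⁻¹ = c-adj⁻¹
      ; good    = good′
      }
      where
      good′ : ∀ {v} i → Adj G v (c i) → Adj G v (c (s² i)) → v ≡ c (s i) ⊎ Adj G v (c (s i))
      good′ {v} i v~0 v~2 with any? (λ j → v ≟F c j)
      ... | no v∉C = inj₂ (good v (λ j e → v∉C (j , e)) i (s i) (s² i) (succᵇ-s i) (succᵇ-s (s i)) v~0 v~2)
      -- `GoodNeighbors` speaks of vertices off the cycle only. A cycle vertex adjacent to both
      -- `c i` and `c (s² i)` must be `c (s i)`, by the excluded cycle lengths.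
      ... | yes (j , refl) with c-adj⁻¹ {j} {i} v~0 | c-adj⁻¹ {j} {s² i} v~2
      ...   | inj₂ refl | _      = inj₁ refl
      ...   | inj₁ refl | inj₁ e = ⊥-elim (s²≢ (s j) e)
      ...   | inj₁ refl | inj₂ e = ⊥-elim (s⁴≢ j (sym e))

    -- A single clique vertex `a` starts the growth: it is adjacent to the cycle vertices 0 and 1
    -- but not to n - 1 or 2, hence on the edge between 0 and 1.
    necklace-diverges : Fin m → Diverges G
    necklace-diverges a = diverges good-cycle {i} (on
      (λ h → contradiction (trans (sym h) (trans (E-apex a (s² i)) (cong (_<ᵇ 2) toℕ-s²i))) λ ())
      (trans (E-apex a (s³ i)) (cong (_<ᵇ 2) toℕ-s³i))
      (trans (E-apex a (s⁴ i)) (cong (_<ᵇ 2) toℕ-s⁴i))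
      (λ h → contradiction (trans (sym h) (trans (E-apex a (s (s⁴ i))) (cong (_<ᵇ 2) toℕ-s⁵i))) λ ()))
      where
      3+n∸3 : 3 + (n ∸ 3) ≡ n
      3+n∸3 = m+[n∸m]≡n (≤-trans (m≤m+n 3 2) 5≤n)
      -- Chosen so that s³ i is index 0: the clique sits on the edge v₀v₁.
      i : Fin n
      i = (n ∸ 3) mod n
      n∸3<n : n ∸ 3 < n
      n∸3<n = subst (suc (n ∸ 3) ≤_) 3+n∸3 (s≤s (m≤n+m (n ∸ 3) 2))
      toℕ-i : toℕ i ≡ n ∸ 3
      toℕ-i = trans (toℕ-fromℕ< (m%n<n (n ∸ 3) n)) (m<n⇒m%n≡m n∸3<n)
      step : ∀ {j k} → toℕ j ≡ k → suc k < n → toℕ (s j) ≡ suc k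
      step {j} refl = s-step j
      toℕ-s²i : toℕ (s² i) ≡ 2 + (n ∸ 3)
      toℕ-s²i = step (step toℕ-i (subst (2 + (n ∸ 3) ≤_) 3+n∸3 (n≤1+n _)))
        (subst (3 + (n ∸ 3) ≤_) 3+n∸3 ≤-refl)
      toℕ-s³i : toℕ (s³ i) ≡ 0
      toℕ-s³i = s-wrap (s² i) (trans (cong suc toℕ-s²i) 3+n∸3)
      toℕ-s⁴i : toℕ (s⁴ i) ≡ 1
      toℕ-s⁴i = step toℕ-s³i (≤-trans (m≤m+n 2 3) 5≤n)
      toℕ-s⁵i : toℕ (s (s⁴ i)) ≡ 2
      toℕ-s⁵i = step toℕ-s⁴i (≤-trans (m≤m+n 3 2) 5≤n)

theorem4 : (G : Graph) → Simple G → (n m : ℕ) → 5 ≤ n → 1 ≤ m →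
    (f : V (Necklace n m) → V G) → InducedEmbedding (Necklace n m) G f →
    GoodNeighbors G n (λ i → f (i ↑ˡ m)) →
    Diverges G
-- The successor patterns provide the `NonZero` instance for `n` and the clique vertex `zero`.
theorem4 G simple n@(suc _) (suc m) 5≤n _ f embedding good =
  Rotation.necklace-diverges n 5≤n G simple (suc m) f embedding good zero
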